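{- For every variable $x\in V$, every command $c\in\mathcal C$ and every relation $r\subseteq\Sigma\times\Sigma$, $$(\mathbf{var}\,x\cdot c)\Cap\mathbf{rely}\,r\;\ge\;\big(\mathbf{var}\,x\cdot c\Cap\mathbf{rely}((\mathsf E_xr)\cap\mathrm{id}(x))\big).$$
   Context: Commands. $(\mathcal C,\le,\bigwedge,\bigsqcup,\bot,\top)$ is a complete distributive lattice (with arbitrary meet $\bigwedge$, binary meet $\sqcap$, arbitrary join $\bigsqcup$ and binary join $\sqcup$) whose elements are called commands ($c\ge d$ is read "$c$ is refined by $d$"). It has an associative sequential composition $;$ with identity $\mathbf{nil}$, monotone in both arguments, and an associative, commutative, idempotent, monotone weak conjunction $\Cap$. Iterations: $c^0=\mathbf{nil}$, $c^{i+1}=c;c^i$; $c^\star$ (resp. $c^\omega$) is the least (resp. greatest) fixed point of $y\mapsto\mathbf{nil}\sqcup c;y$; $c^\infty=c^\omega;\bot$. One has $c^\star=\bigsqcup_{i\in\mathbb N}c^i$ and $c^\omega=c^\star\sqcup c^\infty$. States and relations. $V$ is a countable set of variables, $S$ a set, $\Sigma$ the set of partial functions $V\rightharpoonup S$. For $W\subseteq V$, $\mathrm{id}(W)$ relates $\sigma,\sigma'\in\Sigma$ iff they agree on every variable in $W$; $\mathrm{id}(x)=\mathrm{id}(\{x\})$, $\mathrm{id}(\overline x)=\mathrm{id}(V\setminus\{x\})$, and $\mathrm{id}$ is the identity relation on $\Sigma$. For $p\subseteq\Sigma$, $\mathsf E_x p$ is the image of $p$ under $\mathrm{id}(\overline x)$.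 For $r\subseteq\Sigma\times\Sigma$ (with $\circ$ denoting left-to-right relational composition), $\mathsf E^{\mathsf{first}}_x r=\mathrm{id}(\overline x)\circ r$, $\mathsf E^{\mathsf{last}}_x r=r\circ\mathrm{id}(\overline x)$, $\mathsf E_x r=\mathrm{id}(\overline x)\circ r\circ\mathrm{id}(\overline x)$. $\overline r$ is the complement of $r$. A relation $g$ is reflexive if $\mathrm{id}\subseteq g$. Primitive commands. $\tau:\mathcal P(\Sigma)\to\mathcal C$ (tests) and $\pi,\epsilon:\mathcal P(\Sigma\times\Sigma)\to\mathcal A$ (program and environment steps) are injective homomorphisms of complete Boolean algebras onto complete Boolean sub-algebras of $\mathcal C$ (joins, and nonempty meets, computed in $\mathcal C$; complement relative to the greatest element of the sub-algebra), with $\tau(\emptyset)=\pi(\emptyset)=\epsilon(\emptyset)=\bot$ and $\tau(\Sigma)=\mathbf{nil}$. $\mathcal A\subseteq\mathcal C$ is the complete Boolean sub-algebra of atomic steps, in which $\boldsymbol\pi=\pi(\Sigma\times\Sigma)$ and $\boldsymbol\epsilon=\epsilon(\Sigma\times\Sigma)$ are complementary; $\boldsymbol\alpha=\boldsymbol\pi\sqcup\boldsymbol\epsilon$. $\mathbf{chaos}=\boldsymbol\alpha^\omega$ is the identity of $\Cap$, and $a=a\Cap(\boldsymbol\alpha;\mathbf{chaos})$ for all $a\in\mathcal A$. Localisation. For each $x\in V$ there are unary operators $\mathsf E_x,\mathsf E^{\mathsf{first}}_x,\mathsf E^{\mathsf{last}}_x$ on $\mathcal C$ (binding tighter than binary operators).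 Each family $F\in\{\mathsf E,\mathsf E^{\mathsf{first}},\mathsf E^{\mathsf{last}}\}$ satisfies $c\le F_xc$; $F_x(c\sqcap F_xd)=F_xc\sqcap F_xd$; $F_xF_yc=F_yF_xc$; $F_x(\bigsqcup C)=\bigsqcup_{c\in C}F_xc$. Further axioms: $\mathsf E^{\mathsf{first}}_xc\le\mathsf E_xc$; $\mathsf E^{\mathsf{last}}_xc\le\mathsf E_xc$; $\mathsf E_x\mathsf E^{\mathsf{first}}_yc=\mathsf E^{\mathsf{first}}_y\mathsf E_xc$; $\mathsf E_x\mathsf E^{\mathsf{last}}_yc=\mathsf E^{\mathsf{last}}_y\mathsf E_xc$; $\mathsf E^{\mathsf{first}}_x\mathsf E^{\mathsf{last}}_yc=\mathsf E^{\mathsf{last}}_y\mathsf E^{\mathsf{first}}_xc$; $\mathsf E_x\tau(p)=\mathsf E^{\mathsf{first}}_x\tau(p)=\mathsf E^{\mathsf{last}}_x\tau(p)=\tau(\mathsf E_xp)$; $F_x\pi(r)=\pi(F_xr)$ and $F_x\epsilon(r)=\epsilon(F_xr)$ for each of the three $F$; $\mathsf E_x(c;\mathsf E^{\mathsf{first}}_xd)=\mathsf E_xc;\mathsf E_xd=\mathsf E_x(\mathsf E^{\mathsf{last}}_xc;d)$; if $c=c\Cap(\boldsymbol\alpha;\mathbf{chaos})$ then $\mathsf E^{\mathsf{first}}_x(c;d)=\mathsf E^{\mathsf{first}}_xc;d$ and $\mathsf E^{\mathsf{last}}_x(d;c)=d;\mathsf E^{\mathsf{last}}_xc$; $\mathsf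 E_x(c\Cap\mathsf E_xd)=\mathsf E_xc\Cap\mathsf E_xd$; $\mathsf E^{\mathsf{first}}_x(c\Cap\mathsf E^{\mathsf{first}}_xd)=\mathsf E^{\mathsf{first}}_xc\Cap\mathsf E^{\mathsf{first}}_xd$; for $a\in\mathcal A$ with $\mathsf E_xa=\mathsf E^{\mathsf{last}}_xa$, $\mathsf E_x(a^\infty)=(\mathsf E_xa)^\infty$. Derived commands. $\mathbf{guar}\,g=(\pi(g)\sqcup\boldsymbol\epsilon)^\omega$; $\mathbf{demand}\,r=(\epsilon(r)\sqcup\boldsymbol\pi)^\omega$; $\mathbf{rely}\,r=(\boldsymbol\alpha\sqcup\epsilon(\overline r);\top)^\omega=\boldsymbol\alpha^\omega;(\mathbf{nil}\sqcup\epsilon(\overline r);\top)$; $\mathbf{term}=\boldsymbol\alpha^\star;\boldsymbol\epsilon^\omega$; $\mathbf{idle}=\mathbf{term}\Cap\mathbf{guar}\,\mathrm{id}$. Known properties of the algebra: $\mathbf{guar}\,g_1\Cap\mathbf{guar}\,g_2=\mathbf{guar}(g_1\cap g_2)$; $\mathbf{guar}\,g\Cap(c;d)=(\mathbf{guar}\,g\Cap c);(\mathbf{guar}\,g\Cap d)$; $\mathbf{rely}\,r_1\ge\mathbf{rely}\,r_2$ if $r_1\subseteq r_2$; $\mathbf{rely}\,r\Cap c\ge c$; $\mathbf{rely}\,r_1\Cap\mathbf{rely}\,r_2=\mathbf{rely}(r_1\cap r_2)$; $\mathbf{rely}\,r\Cap(c;d)\ge(\mathbf{rely}\,r\Cap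 c);(\mathbf{rely}\,r\Cap d)$; $\mathbf{demand}\,r\Cap\mathbf{rely}\,r=\mathbf{demand}\,r$; $\mathbf{idle}=\mathbf{idle}\Cap\mathbf{guar}\,g$ if $g$ is reflexive. Local blocks. $(\mathbf{local}\,x\cdot c)=\mathsf E_x(\mathbf{demand}\,\mathrm{id}(x)\Cap c)\Cap\mathbf{guar}\,\mathrm{id}(x)$ and $(\mathbf{var}\,x\cdot c)=\mathbf{idle};(\mathbf{local}\,x\cdot c);\mathbf{idle}$. -}

module Defs where

open import Algebra.Definitions using (Identity)
open import Algebra.Structures using (IsMonoid; IsCommutativeBand)
open import Data.Maybe.Base using (Maybe)
open import Data.Nat.Base using (ℕ; zero; suc)
open import Data.Product.Base using (_×_; _,_; ∃; proj₁; proj₂)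
open import Level using (Level; Lift; lower) renaming (suc to lsuc)
open import Relation.Binary.Core using (Rel; _Preserves_⟶_; _Preserves₂_⟶_⟶_)
open import Relation.Binary.Definitions using (Minimum; Maximum; _Respects_)
open import Relation.Binary.Lattice using (IsDistributiveLattice)
open import Relation.Binary.PropositionalEquality.Core using (_≡_)
open import Relation.Unary
  using (Pred; _∈_; _⊆_; _≐_; ∁; _∩_; ⋃; ⋂; ｛_｝; _⟨∘⟩_)
open import Relation.Unary.Polymorphic using (∅; U)

------------------------------------------------------------------------
-- States and relations

module StateSpace {ℓ : Level} (V S : Set ℓ) where

  -- The partial functions V ⇀ S.
  State : Set ℓ
  State = V → Maybe S

  StateRel : Set (lsuc ℓ)
  StateRel = Pred (State × State) ℓ

  -- `nothing` counts as a value here: σ and σ′ agree on a variable also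
  -- when both are undefined there.
  idOn : Pred V ℓ → StateRel
  idOn W (σ , σ′) = ∀ y → y ∈ W → σ y ≡ σ′ y

  idVar : V → StateRel
  idVar x = idOn ｛ x ｝

  idExcept : V → StateRel
  idExcept x = idOn (∁ ｛ x ｝)

  idState : StateRel
  idState (σ , σ′) = σ ≡ σ′

  E-set : V → Pred State ℓ → Pred State ℓ
  E-set x p σ′ = ∃ λ σ → σ ∈ p × (σ , σ′) ∈ idExcept x

  -- _⟨∘⟩_ composes from left to right.
  E-first E-last E-rel : V → StateRel → StateRel
  E-first x r = idExcept x ⟨∘⟩ r
  E-last  x r = r ⟨∘⟩ idExcept x
  E-rel   x r = idExcept x ⟨∘⟩ (r ⟨∘⟩ idExcept x)

------------------------------------------------------------------------
-- Complete distributive lattices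

-- "Distributive" is finite distributivity only.  Arbitrary joins and
-- meets are those of families indexed by a type at the level of the
-- carrier, which covers the subsets P : Pred 𝒞 ℓ as the families
-- proj₁ : ∃ P → 𝒞.
record CompleteDistributiveLattice (ℓ : Level) : Set (lsuc ℓ) where
  infix  4 _≈_ _≤_ _≥_
  infixr 5 _⊔_
  infixr 6 _⊓_
  field
    𝒞       : Set ℓ
    _≈_ _≤_ : Rel 𝒞 ℓ
    _⊔_ _⊓_ : 𝒞 → 𝒞 → 𝒞
    ⨆ ⨅     : {I : Set ℓ} → (I → 𝒞) → 𝒞
    ⊥ ⊤     : 𝒞
    isDistributiveLattice : IsDistributiveLattice _≈_ _≤_ _⊔_ _⊓_
    ⨆-upper    : {I : Set ℓ} (f : I → 𝒞) (i : I) → f i ≤ ⨆ f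
    ⨆-least    : {I : Set ℓ} (f : I → 𝒞) (c : 𝒞) → (∀ i → f i ≤ c) → ⨆ f ≤ c
    ⨅-lower    : {I : Set ℓ} (f : I → 𝒞) (i : I) → ⨅ f ≤ f i
    ⨅-greatest : {I : Set ℓ} (f : I → 𝒞) (c : 𝒞) → (∀ i → c ≤ f i) → c ≤ ⨅ f
    minimum : Minimum _≤_ ⊥
    maximum : Maximum _≤_ ⊤

  open IsDistributiveLattice isDistributiveLattice public
    hiding (isLattice; ∧-distribˡ-∨)

  _≥_ : Rel 𝒞 ℓ
  c ≥ d = d ≤ c

  -- Least and greatest fixed points, by the Knaster–Tarski construction;
  -- the four lemmas below justify the names.
  μ ν : (𝒞 → 𝒞) → 𝒞
  μ f = ⨅ {I = ∃ λ y → f y ≤ y} proj₁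
  ν f = ⨆ {I = ∃ λ y → y ≤ f y} proj₁

  module _ (f : 𝒞 → 𝒞) (f-mono : f Preserves _≤_ ⟶ _≤_) where

    μ-fixed : f (μ f) ≈ μ f
    μ-fixed = antisym fμ≤μ (⨅-lower proj₁ (f (μ f) , f-mono fμ≤μ))
      where
      fμ≤μ : f (μ f) ≤ μ f
      fμ≤μ = ⨅-greatest proj₁ (f (μ f))
               λ (y , fy≤y) → trans (f-mono (⨅-lower proj₁ (y , fy≤y))) fy≤y

    μ-least : ∀ y → f y ≈ y → μ f ≤ y
    μ-least y fy≈y = ⨅-lower proj₁ (y , reflexive fy≈y)

    ν-fixed : f (ν f) ≈ ν f
    ν-fixed = antisym (⨆-upper proj₁ (f (ν f) , f-mono ν≤fν)) ν≤fν
      where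
      ν≤fν : ν f ≤ f (ν f)
      ν≤fν = ⨆-least proj₁ (f (ν f))
               λ (y , y≤fy) → trans y≤fy (f-mono (⨆-upper proj₁ (y , y≤fy)))

    ν-greatest : ∀ y → f y ≈ y → y ≤ ν f
    ν-greatest y fy≈y = ⨆-upper proj₁ (y , reflexive (Eq.sym fy≈y))

module _ {ℓ : Level} (L : CompleteDistributiveLattice ℓ) where

  open CompleteDistributiveLattice L

  -- b is the complement of a relative to the greatest element `top` of a
  -- sub-algebra whose least element is ⊥.
  record IsRelativeComplement (top a b : 𝒞) : Set ℓ where
    field
      join : a ⊔ b ≈ top
      meet : a ⊓ b ≈ ⊥

  -- Closure under ⨆ includes the empty join ⊥.
  record IsCompleteBooleanSubalgebra (top : 𝒞) (A : Pred 𝒞 ℓ) : Set (lsuc ℓ) where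
    field
      respects   : A Respects _≈_
      ⨆-closed   : {I : Set ℓ} (f : I → 𝒞) → (∀ i → f i ∈ A) → ⨆ f ∈ A
      ⨅-closed   : {I : Set ℓ} → I → (f : I → 𝒞) → (∀ i → f i ∈ A) → ⨅ f ∈ A
      top-closed : top ∈ A
      greatest   : ∀ {a} → a ∈ A → a ≤ top
      complement : ∀ {a} → a ∈ A → ∃ λ b → b ∈ A × IsRelativeComplement top a b

  -- Injective homomorphisms of complete Boolean algebras from the powerset
  -- of X; the image is then a complete Boolean sub-algebra with greatest
  -- element h U.  The powerset of X is a Boolean algebra only
  -- classically, and indeed ∁-homo, ⨆-homo and injective together force
  -- p ∪ ∁ p to be all of X, so no separate assumption of excluded middle
  -- is made.
  record IsCompleteBooleanEmbedding {X : Set ℓ} (h : Pred X ℓ → 𝒞) : Set (lsuc ℓ) where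
    field
      cong      : ∀ {p q} → p ≐ q → h p ≈ h q
      injective : ∀ {p q} → h p ≈ h q → p ≐ q
      ⨆-homo    : {I : Set ℓ} (P : I → Pred X ℓ) → h (⋃ I P) ≈ ⨆ (λ i → h (P i))
      ⨅-homo    : {I : Set ℓ} → I → (P : I → Pred X ℓ) → h (⋂ I P) ≈ ⨅ (λ i → h (P i))
      ∁-homo    : ∀ p → IsRelativeComplement (h U) (h p) (h (∁ p))
      ∅-homo    : h ∅ ≈ ⊥

------------------------------------------------------------------------
-- Sequential composition, weak conjunction and iteration

record CommandLattice (ℓ : Level) : Set (lsuc ℓ) where
  infixr 7 _⨾_
  infixr 6 _⋒_
  field
    lattice : CompleteDistributiveLattice ℓ
  open CompleteDistributiveLattice lattice public
  field
    _⨾_    : 𝒞 → 𝒞 → 𝒞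
    nil    : 𝒞
    _⋒_    : 𝒞 → 𝒞 → 𝒞
    ⨾-isMonoid          : IsMonoid _≈_ _⨾_ nil
    ⨾-mono              : _⨾_ Preserves₂ _≤_ ⟶ _≤_ ⟶ _≤_
    ⋒-isCommutativeBand : IsCommutativeBand _≈_ _⋒_
    ⋒-mono              : _⋒_ Preserves₂ _≤_ ⟶ _≤_ ⟶ _≤_

  infix 9 _^_ _^⋆ _^ω _^∞

  _^_ : 𝒞 → ℕ → 𝒞
  c ^ zero  = nil
  c ^ suc i = c ⨾ c ^ i

  _^⋆ _^ω _^∞ : 𝒞 → 𝒞
  c ^⋆ = μ (λ y → nil ⊔ c ⨾ y)
  c ^ω = ν (λ y → nil ⊔ c ⨾ y)
  c ^∞ = c ^ω ⨾ ⊥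

------------------------------------------------------------------------
-- Primitive and derived commands

record PrimitiveCommands {ℓ : Level} (V S : Set ℓ) : Set (lsuc ℓ) where
  open StateSpace V S public
  field
    commandLattice : CommandLattice ℓ
  open CommandLattice commandLattice public
  field
    ^⋆-⨆ : ∀ c → c ^⋆ ≈ ⨆ {I = Lift ℓ ℕ} (λ i → c ^ lower i)
    ^ω-⊔ : ∀ c → c ^ω ≈ c ^⋆ ⊔ c ^∞

    τ   : Pred State ℓ → 𝒞
    π ε : StateRel → 𝒞
    τ-embedding : IsCompleteBooleanEmbedding lattice τ
    π-embedding : IsCompleteBooleanEmbedding lattice π
    ε-embedding : IsCompleteBooleanEmbedding lattice ε
    τ-U : τ U ≈ nil

  𝛑 : 𝒞
  𝛑 = π U

  𝛆 : 𝒞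
  𝛆 = ε U

  𝛂 : 𝒞
  𝛂 = 𝛑 ⊔ 𝛆

  chaos : 𝒞
  chaos = 𝛂 ^ω

  -- 𝛂 is the greatest element of 𝒜 because 𝛑 and 𝛆 are complementary
  -- in 𝒜; 𝛑⊓𝛆 is the other half of complementarity.
  field
    𝒜 : Pred 𝒞 ℓ
    𝒜-subalgebra : IsCompleteBooleanSubalgebra lattice 𝛂 𝒜
    π∈𝒜 : ∀ r → π r ∈ 𝒜
    ε∈𝒜 : ∀ r → ε r ∈ 𝒜
    𝛑⊓𝛆 : 𝛑 ⊓ 𝛆 ≈ ⊥
    chaos-identity : Identity _≈_ chaos _⋒_
    𝒜-⋒ : ∀ {a} → a ∈ 𝒜 → a ≈ a ⋒ (𝛂 ⨾ chaos)

  guar demand rely : StateRel → 𝒞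
  guar   g = (π g ⊔ 𝛆) ^ω
  demand r = (ε r ⊔ 𝛑) ^ω
  rely   r = (𝛂 ⊔ ε (∁ r) ⨾ ⊤) ^ω

  term idle : 𝒞
  term = 𝛂 ^⋆ ⨾ 𝛆 ^ω
  idle = term ⋒ guar idState

------------------------------------------------------------------------
-- Localisation

module _ {ℓ : Level} (L : CompleteDistributiveLattice ℓ) {V : Set ℓ} where

  open CompleteDistributiveLattice L

  record IsLocalisation (F : V → 𝒞 → 𝒞) : Set (lsuc ℓ) where
    field
      cong      : ∀ x {c d} → c ≈ d → F x c ≈ F x d
      extensive : ∀ x c → c ≤ F x c
      ⊓-local   : ∀ x c d → F x (c ⊓ F x d) ≈ F x c ⊓ F x d
      commute   : ∀ x y c → F x (F y c) ≈ F y (F x c)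
      ⨆-distrib : ∀ x {I : Set ℓ} (f : I → 𝒞) → F x (⨆ f) ≈ ⨆ (λ i → F x (f i))

record LocalisationAlgebra {ℓ : Level} (V S : Set ℓ) : Set (lsuc ℓ) where
  field
    primitives : PrimitiveCommands V S
  open PrimitiveCommands primitives public
  field
    E Eᶠⁱʳˢᵗ Eˡᵃˢᵗ : V → 𝒞 → 𝒞

    E-localisation      : IsLocalisation lattice E
    Eᶠⁱʳˢᵗ-localisation : IsLocalisation lattice Eᶠⁱʳˢᵗ
    Eˡᵃˢᵗ-localisation  : IsLocalisation lattice Eˡᵃˢᵗ

    Eᶠⁱʳˢᵗ≤E : ∀ x c → Eᶠⁱʳˢᵗ x c ≤ E x c
    Eˡᵃˢᵗ≤E  : ∀ x c → Eˡᵃˢᵗ x c ≤ E x c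

    E-Eᶠⁱʳˢᵗ-commute     : ∀ x y c → E x (Eᶠⁱʳˢᵗ y c) ≈ Eᶠⁱʳˢᵗ y (E x c)
    E-Eˡᵃˢᵗ-commute      : ∀ x y c → E x (Eˡᵃˢᵗ y c) ≈ Eˡᵃˢᵗ y (E x c)
    Eᶠⁱʳˢᵗ-Eˡᵃˢᵗ-commute : ∀ x y c → Eᶠⁱʳˢᵗ x (Eˡᵃˢᵗ y c) ≈ Eˡᵃˢᵗ y (Eᶠⁱʳˢᵗ x c)

    E-τ      : ∀ x p → E x (τ p) ≈ τ (E-set x p)
    Eᶠⁱʳˢᵗ-τ : ∀ x p → Eᶠⁱʳˢᵗ x (τ p) ≈ τ (E-set x p)
    Eˡᵃˢᵗ-τ  : ∀ x p → Eˡᵃˢᵗ x (τ p) ≈ τ (E-set x p)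

    E-π      : ∀ x r → E x (π r) ≈ π (E-rel x r)
    Eᶠⁱʳˢᵗ-π : ∀ x r → Eᶠⁱʳˢᵗ x (π r) ≈ π (E-first x r)
    Eˡᵃˢᵗ-π  : ∀ x r → Eˡᵃˢᵗ x (π r) ≈ π (E-last x r)

    E-ε      : ∀ x r → E x (ε r) ≈ ε (E-rel x r)
    Eᶠⁱʳˢᵗ-ε : ∀ x r → Eᶠⁱʳˢᵗ x (ε r) ≈ ε (E-first x r)
    Eˡᵃˢᵗ-ε  : ∀ x r → Eˡᵃˢᵗ x (ε r) ≈ ε (E-last x r)

    E-⨾-Eᶠⁱʳˢᵗ : ∀ x c d → E x (c ⨾ Eᶠⁱʳˢᵗ x d) ≈ E x c ⨾ E x d
    E-Eˡᵃˢᵗ-⨾  : ∀ x c d → E x c ⨾ E x d ≈ E x (Eˡᵃˢᵗ x c ⨾ d)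

    Eᶠⁱʳˢᵗ-⨾ : ∀ x c d → c ≈ c ⋒ (𝛂 ⨾ chaos) → Eᶠⁱʳˢᵗ x (c ⨾ d) ≈ Eᶠⁱʳˢᵗ x c ⨾ d
    Eˡᵃˢᵗ-⨾  : ∀ x c d → c ≈ c ⋒ (𝛂 ⨾ chaos) → Eˡᵃˢᵗ x (d ⨾ c) ≈ d ⨾ Eˡᵃˢᵗ x c

    E-⋒      : ∀ x c d → E x (c ⋒ E x d) ≈ E x c ⋒ E x d
    Eᶠⁱʳˢᵗ-⋒ : ∀ x c d → Eᶠⁱʳˢᵗ x (c ⋒ Eᶠⁱʳˢᵗ x d) ≈ Eᶠⁱʳˢᵗ x c ⋒ Eᶠⁱʳˢᵗ x d

    E-^∞ : ∀ x a → a ∈ 𝒜 → E x a ≈ Eˡᵃˢᵗ x a → E x (a ^∞) ≈ (E x a) ^∞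

    -- Established properties of the underlying concurrent refinement
    -- algebra.  They rest on axioms relating ⨾, ⋒ and atomic steps that are
    -- not repeated here, so they are assumed.
    guar-⋒-guar : ∀ g₁ g₂ → guar g₁ ⋒ guar g₂ ≈ guar (g₁ ∩ g₂)
    guar-⋒-⨾    : ∀ g c d → guar g ⋒ (c ⨾ d) ≈ (guar g ⋒ c) ⨾ (guar g ⋒ d)
    rely-⨾      : ∀ r → rely r ≈ 𝛂 ^ω ⨾ (nil ⊔ ε (∁ r) ⨾ ⊤)
    rely-mono   : ∀ {r₁ r₂} → r₁ ⊆ r₂ → rely r₁ ≥ rely r₂
    rely-remove : ∀ r c → rely r ⋒ c ≥ c
    rely-⋒-rely : ∀ r₁ r₂ → rely r₁ ⋒ rely r₂ ≈ rely (r₁ ∩ r₂)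
    rely-⋒-⨾    : ∀ r c d → rely r ⋒ (c ⨾ d) ≥ (rely r ⋒ c) ⨾ (rely r ⋒ d)
    demand-⋒-rely : ∀ r → demand r ⋒ rely r ≈ demand r
    idle-guar     : ∀ g → idState ⊆ g → idle ≈ idle ⋒ guar g

  infix 5 local_·_ var_·_

  local_·_ var_·_ : V → 𝒞 → 𝒞
  local x · c = E x (demand (idVar x) ⋒ c) ⋒ guar (idVar x)
  var   x · c = idle ⨾ (local x · c) ⨾ idle

{-# OPTIONS --safe #-}

-- Conjoining rely r to a sequential composition is refined by conjoining it
-- to each component, and can be dropped from both idles, so it suffices to
-- bound the local block.  There rely (E-rel x r ∩ idVar x) splits into
-- rely (E-rel x r) ⋒ rely (idVar x).  The second factor is absorbed by
-- demand (idVar x).  The first moves out of E x, where it refines rely r: it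
-- is a fixed point of E x, because 𝛂 and ε (∁ (E-rel x r)) are and fixed
-- points are closed under the operations that build rely from these two.

module Submission where

open import Algebra.Structures using (module IsCommutativeBand)
open import Data.Bool.Base using (Bool; true; false)
open import Data.Nat.Base using (ℕ; zero; suc)
open import Data.Product.Base using (_,_; proj₂)
open import Function.Bundles using (_↣_)
open import Level using (Level; Lift; lift)
open import Relation.Binary.Bundles using (Poset)
import Relation.Binary.Reasoning.PartialOrder as PosetReasoning
import Relation.Binary.PropositionalEquality.Core as ≡
open import Relation.Unary using (_∈_; _⊆_; ∁; _∩_)
open import Relation.Unary.Polymorphic using (U)
open import Defs

module StateSpaceProperties {ℓ : Level} (V S : Set ℓ) where

  open StateSpace V S

  idExcept-refl : ∀ x {σ} → (σ , σ) ∈ idExcept x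
  idExcept-refl x y _ = ≡.refl

  idExcept-sym : ∀ x {σ ρ} → (σ , ρ) ∈ idExcept x → (ρ , σ) ∈ idExcept x
  idExcept-sym x σ~ρ y y≢x = ≡.sym (σ~ρ y y≢x)

  idExcept-trans : ∀ x {σ ρ θ} →
    (σ , ρ) ∈ idExcept x → (ρ , θ) ∈ idExcept x → (σ , θ) ∈ idExcept x
  idExcept-trans x σ~ρ ρ~θ y y≢x = ≡.trans (σ~ρ y y≢x) (ρ~θ y y≢x)

  E-rel-extensive : ∀ x r → r ⊆ E-rel x r
  E-rel-extensive x r {σ , σ′} σrσ′ =
    σ , idExcept-refl x , σ′ , σrσ′ , idExcept-refl x

  -- `idExcept x` is an equivalence, so `E-rel x r` is saturated under it in both arguments, and the
  -- complement of a saturated relation is saturated.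
  E-rel-∁-E-rel : ∀ x r → E-rel x (∁ (E-rel x r)) ⊆ ∁ (E-rel x r)
  E-rel-∁-E-rel x r (_ , σ~ρ , _ , ρρ′∉Er , ρ′~σ′) (θ , σ~θ , θ′ , θrθ′ , θ′~σ′) =
    ρρ′∉Er ( θ  , idExcept-trans x (idExcept-sym x σ~ρ) σ~θ
           , θ′ , θrθ′ , idExcept-trans x θ′~σ′ (idExcept-sym x ρ′~σ′) )

module CompleteLatticeProperties {ℓ : Level} (L : CompleteDistributiveLattice ℓ) where

  open CompleteDistributiveLattice L

  poset : Poset ℓ ℓ ℓ
  poset = record { isPartialOrder = isPartialOrder }

  ⊔-lub : ∀ {c d e} → c ≤ e → d ≤ e → c ⊔ d ≤ e
  ⊔-lub {c} {d} = supremum c d .proj₂ .proj₂ _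

  ⊔-mono : ∀ {c c′ d d′} → c ≤ c′ → d ≤ d′ → c ⊔ d ≤ c′ ⊔ d′
  ⊔-mono {c} {c′} {d} {d′} c≤c′ d≤d′ =
    ⊔-lub (trans c≤c′ (x≤x∨y c′ d′)) (trans d≤d′ (y≤x∨y c′ d′))

  ⨆-mono : {I : Set ℓ} {f g : I → 𝒞} → (∀ i → f i ≤ g i) → ⨆ f ≤ ⨆ g
  ⨆-mono {f = f} {g} f≤g = ⨆-least f (⨆ g) λ i → trans (f≤g i) (⨆-upper g i)

  ν-mono : {f g : 𝒞 → 𝒞} → (∀ y → f y ≤ g y) → ν f ≤ ν g
  ν-mono f≤g = ⨆-least _ _ λ (y , y≤fy) → ⨆-upper _ (y , trans y≤fy (f≤g y))

  module LocalisationProperties {V : Set ℓ} {F : V → 𝒞 → 𝒞}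
                                (isLocalisation : IsLocalisation L F) where

    open IsLocalisation isLocalisation

    private
      -- Recasts a binary join as an indexed one, the form in which `⨆-distrib` applies.
      pair : 𝒞 → 𝒞 → Lift ℓ Bool → 𝒞
      pair c d (lift true)  = c
      pair c d (lift false) = d

    ⊔-subdistrib : ∀ x c d → F x (c ⊔ d) ≤ F x c ⊔ F x d
    ⊔-subdistrib x c d = begin
      F x (c ⊔ d)                 ≈⟨ cong x ⊔≈⨆ ⟩
      F x (⨆ (pair c d))          ≈⟨ ⨆-distrib x (pair c d) ⟩
      ⨆ (λ i → F x (pair c d i))  ≤⟨ ⨆-least _ _ (λ { (lift true)  → x≤x∨y _ _
                                                    ; (lift false) → y≤x∨y _ _ }) ⟩
      F x c ⊔ F x d               ∎
      where
      open PosetReasoning poset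
      ⊔≈⨆ : c ⊔ d ≈ ⨆ (pair c d)
      ⊔≈⨆ = antisym
        (⊔-lub (⨆-upper (pair c d) (lift true)) (⨆-upper (pair c d) (lift false)))
        (⨆-least _ _ λ { (lift true)  → x≤x∨y c d
                       ; (lift false) → y≤x∨y c d })

    -- When `c ≤ d`, the join of the pair is `d`, so preservation of joins puts `F x c` below
    -- `F x d`.
    mono : ∀ x {c d} → c ≤ d → F x c ≤ F x d
    mono x {c} {d} c≤d = begin
      F x c                       ≤⟨ ⨆-upper (λ i → F x (pair c d i)) (lift true) ⟩
      ⨆ (λ i → F x (pair c d i))  ≈⟨ ⨆-distrib x (pair c d) ⟨
      F x (⨆ (pair c d))          ≈⟨ cong x ⨆≈d ⟩
      F x d                       ∎
      where
      open PosetReasoning poset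
      ⨆≈d : ⨆ (pair c d) ≈ d
      ⨆≈d = antisym (⨆-least _ d λ { (lift true) → c≤d ; (lift false) → refl })
                    (⨆-upper (pair c d) (lift false))

module LocalisationAlgebraProperties {ℓ : Level} {V S : Set ℓ}
                                     (A : LocalisationAlgebra V S) where

  open LocalisationAlgebra A
  open StateSpaceProperties V S
  open CompleteLatticeProperties lattice
  open LocalisationProperties E-localisation
  open PosetReasoning poset

  module E = IsLocalisation E-localisation
  module Eᶠ = IsLocalisation Eᶠⁱʳˢᵗ-localisation
  module Eˡ = IsLocalisation Eˡᵃˢᵗ-localisation
  module τ = IsCompleteBooleanEmbedding τ-embedding
  module π = IsCompleteBooleanEmbedding π-embedding
  module ε = IsCompleteBooleanEmbedding ε-embedding
  open IsCommutativeBand ⋒-isCommutativeBand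
    using ()
    renaming ( assoc to ⋒-assoc; comm to ⋒-comm
             ; ∙-cong to ⋒-cong; ∙-congˡ to ⋒-congˡ; ∙-congʳ to ⋒-congʳ )

  ^ω-mono : ∀ {c d} → c ≤ d → c ^ω ≤ d ^ω
  ^ω-mono c≤d = ν-mono λ y → ⊔-mono refl (⨾-mono c≤d refl)

  ^∞-mono : ∀ {c d} → c ≤ d → c ^∞ ≤ d ^∞
  ^∞-mono c≤d = ⨾-mono (^ω-mono c≤d) refl

  -- As E x is extensive, Closed x c says that c is a fixed point of E x.
  Closed : V → 𝒞 → Set ℓ
  Closed x c = E x c ≤ c

  Closed-resp-≈ : ∀ x {c d} → c ≈ d → Closed x c → Closed x d
  Closed-resp-≈ x {c} {d} c≈d Ec≤c = begin
    E x d  ≈⟨ E.cong x c≈d ⟨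
    E x c  ≤⟨ Ec≤c ⟩
    c      ≈⟨ c≈d ⟩
    d      ∎

  ⊔-closed : ∀ x {c d} → Closed x c → Closed x d → Closed x (c ⊔ d)
  ⊔-closed x Ec≤c Ed≤d = trans (⊔-subdistrib x _ _) (⊔-mono Ec≤c Ed≤d)

  ⨆-closed : ∀ x {I : Set ℓ} (f : I → 𝒞) → (∀ i → Closed x (f i)) → Closed x (⨆ f)
  ⨆-closed x f Ef≤f = trans (reflexive (E.⨆-distrib x f)) (⨆-mono Ef≤f)

  -- The axiom distributes `E x` over `⨾` once the second command has been localised at its first
  -- state. Enlarging `d` to `Eᶠⁱʳˢᵗ x d` arranges this, and an upper bound is all that closedness
  -- asks for.
  ⨾-closed : ∀ x {c d} → Closed x c → Closed x d → Closed x (c ⨾ d)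
  ⨾-closed x {c} {d} Ec≤c Ed≤d = begin
    E x (c ⨾ d)           ≤⟨ mono x (⨾-mono refl (Eᶠ.extensive x d)) ⟩
    E x (c ⨾ Eᶠⁱʳˢᵗ x d)  ≈⟨ E-⨾-Eᶠⁱʳˢᵗ x c d ⟩
    E x c ⨾ E x d         ≤⟨ ⨾-mono Ec≤c Ed≤d ⟩
    c ⨾ d                 ∎

  nil-closed : ∀ x → Closed x nil
  nil-closed x = Closed-resp-≈ x τ-U (begin
    E x (τ U)        ≈⟨ E-τ x U ⟩
    τ (E-set x U)    ≈⟨ τ.cong ((λ _ → _) , λ {σ} _ → σ , _ , idExcept-refl x) ⟩
    τ U              ∎)

  π-closed : ∀ x {r} → E-rel x r ⊆ r → Closed x (π r)
  π-closed x {r} Er⊆r =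
    reflexive (Eq.trans (E-π x r) (π.cong (Er⊆r , E-rel-extensive x r)))

  ε-closed : ∀ x {r} → E-rel x r ⊆ r → Closed x (ε r)
  ε-closed x {r} Er⊆r =
    reflexive (Eq.trans (E-ε x r) (ε.cong (Er⊆r , E-rel-extensive x r)))

  𝛂-closed : ∀ x → Closed x 𝛂
  𝛂-closed x = ⊔-closed x (π-closed x _) (ε-closed x _)

  ^-closed : ∀ x {c} → Closed x c → ∀ i → Closed x (c ^ i)
  ^-closed x Ec≤c zero    = nil-closed x
  ^-closed x Ec≤c (suc i) = ⨾-closed x Ec≤c (^-closed x Ec≤c i)

  ^⋆-closed : ∀ x {c} → Closed x c → Closed x (c ^⋆)
  ^⋆-closed x {c} Ec≤c = Closed-resp-≈ x (Eq.sym (^⋆-⨆ c))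
    (⨆-closed x _ λ (lift i) → ^-closed x Ec≤c i)

  -- For closed `a` the side condition of `E-^∞` is automatic: `a`, `E x a` and `Eˡᵃˢᵗ x a`
  -- coincide.
  ^∞-closed : ∀ x {a} → a ∈ 𝒜 → Closed x a → Closed x (a ^∞)
  ^∞-closed x {a} a∈𝒜 Ea≤a =
    trans (reflexive (E-^∞ x a a∈𝒜 Ea≈Eˡa)) (^∞-mono Ea≤a)
    where
    Ea≈Eˡa : E x a ≈ Eˡᵃˢᵗ x a
    Ea≈Eˡa = antisym (trans Ea≤a (Eˡ.extensive x a)) (Eˡᵃˢᵗ≤E x a)

  -- The join that defines `ν` ranges over post-fixed points that need not be closed. The split into
  -- finite and infinite iteration leaves two parts that can be treated separately.
  ^ω-closed : ∀ x {a} → a ∈ 𝒜 → Closed x a → Closed x (a ^ω)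
  ^ω-closed x {a} a∈𝒜 Ea≤a = Closed-resp-≈ x (Eq.sym (^ω-⊔ a))
    (⊔-closed x (^⋆-closed x Ea≤a) (^∞-closed x a∈𝒜 Ea≤a))

  -- The body iterated in `rely r` contains `⊤` and need not lie in `𝒜`, so `^ω-closed` does not
  -- apply to it directly. The form given by `rely-⨾` iterates `𝛂` alone, with at most one violating
  -- step at the end.
  rely-closed : ∀ x r → E-rel x (∁ r) ⊆ ∁ r → Closed x (rely r)
  rely-closed x r E∁r⊆∁r = Closed-resp-≈ x (Eq.sym (rely-⨾ r))
    (⨾-closed x (^ω-closed x top-closed (𝛂-closed x))
      (⊔-closed x (nil-closed x) (⨾-closed x (ε-closed x E∁r⊆∁r) (maximum _))))
    where open IsCompleteBooleanSubalgebra 𝒜-subalgebra using (top-closed)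

  E-⋒-closed : ∀ x c {d} → Closed x d → E x (c ⋒ d) ≤ E x c ⋒ d
  E-⋒-closed x c {d} Ed≤d = begin
    E x (c ⋒ d)      ≤⟨ mono x (⋒-mono refl (E.extensive x d)) ⟩
    E x (c ⋒ E x d)  ≈⟨ E-⋒ x c d ⟩
    E x c ⋒ E x d    ≤⟨ ⋒-mono refl Ed≤d ⟩
    E x c ⋒ d        ∎

  demand-⋒-rely-∩ : ∀ g r c →
    demand g ⋒ (c ⋒ rely (r ∩ g)) ≈ (demand g ⋒ c) ⋒ rely r
  demand-⋒-rely-∩ g r c = begin-equality
    demand g ⋒ (c ⋒ rely (r ∩ g))         ≈⟨ ⋒-assoc _ _ _ ⟨
    (demand g ⋒ c) ⋒ rely (r ∩ g)         ≈⟨ ⋒-congˡ (rely-⋒-rely r g) ⟨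
    -- Regrouping makes `demand g` and `rely g` adjacent, ready for absorption.
    (demand g ⋒ c) ⋒ (rely r ⋒ rely g)    ≈⟨ ⋒-cong (⋒-comm _ _) (⋒-comm _ _) ⟩
    (c ⋒ demand g) ⋒ (rely g ⋒ rely r)    ≈⟨ ⋒-assoc _ _ _ ⟨
    ((c ⋒ demand g) ⋒ rely g) ⋒ rely r    ≈⟨ ⋒-congʳ (⋒-assoc _ _ _) ⟩
    (c ⋒ (demand g ⋒ rely g)) ⋒ rely r    ≈⟨ ⋒-congʳ (⋒-congˡ (demand-⋒-rely g)) ⟩
    (c ⋒ demand g) ⋒ rely r               ≈⟨ ⋒-congʳ (⋒-comm _ _) ⟩
    (demand g ⋒ c) ⋒ rely r               ∎

  -- `rely r` itself need not be closed. Widening `r` to `E-rel x r` lets the rely leave `E x`; as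
  -- `r` is contained in `E-rel x r`, it is then below `rely r`.
  local-⋒-rely : ∀ x c r →
    rely r ⋒ (local x · c) ≥ (local x · (c ⋒ rely (E-rel x r ∩ idVar x)))
  local-⋒-rely x c r = begin
    E x (demand (idVar x) ⋒ (c ⋒ rely (Er ∩ idVar x))) ⋒ guar (idVar x)
      ≈⟨ ⋒-congʳ (E.cong x (demand-⋒-rely-∩ (idVar x) Er c)) ⟩
    E x ((demand (idVar x) ⋒ c) ⋒ rely Er) ⋒ guar (idVar x)
      ≤⟨ ⋒-mono (E-⋒-closed x _ (rely-closed x Er (E-rel-∁-E-rel x r))) refl ⟩
    (E x (demand (idVar x) ⋒ c) ⋒ rely Er) ⋒ guar (idVar x)
      ≤⟨ ⋒-mono (⋒-mono refl (rely-mono (E-rel-extensive x r))) refl ⟩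
    (E x (demand (idVar x) ⋒ c) ⋒ rely r) ⋒ guar (idVar x)
      ≈⟨ ⋒-congʳ (⋒-comm _ _) ⟩
    (rely r ⋒ E x (demand (idVar x) ⋒ c)) ⋒ guar (idVar x)
      ≈⟨ ⋒-assoc _ _ _ ⟩
    rely r ⋒ (local x · c)
      ∎
    where
    Er : StateRel
    Er = E-rel x r

  var-⋒-rely : ∀ x c r →
    (var x · c) ⋒ rely r ≥ (var x · (c ⋒ rely (E-rel x r ∩ idVar x)))
  var-⋒-rely x c r = begin
    idle ⨾ (local x · (c ⋒ rely (E-rel x r ∩ idVar x))) ⨾ idle
      ≤⟨ ⨾-mono (rely-remove r idle) (⨾-mono (local-⋒-rely x c r) (rely-remove r idle)) ⟩
    (rely r ⋒ idle) ⨾ (rely r ⋒ (local x · c)) ⨾ (rely r ⋒ idle)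
      -- As `⨾` nests to the right, the rely is gathered from the inner composition before the outer
      -- one.
      ≤⟨ ⨾-mono refl (rely-⋒-⨾ r _ _) ⟩
    (rely r ⋒ idle) ⨾ (rely r ⋒ ((local x · c) ⨾ idle))
      ≤⟨ rely-⋒-⨾ r _ _ ⟩
    rely r ⋒ (var x · c)
      ≈⟨ ⋒-comm _ _ ⟩
    (var x · c) ⋒ rely r
      ∎

mainTheorem2 : ∀ {ℓ} (V S : Set ℓ) → V ↣ ℕ → (A : LocalisationAlgebra V S) →
    let open LocalisationAlgebra A in
    ∀ (x : V) (c : 𝒞) (r : StateRel) →
    (var x · c) ⋒ rely r ≥ (var x · (c ⋒ rely (E-rel x r ∩ idVar x)))
mainTheorem2 V S _ A = LocalisationAlgebraProperties.var-⋒-rely A
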